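{- Let $\mathcal{G}=(V,E,\lambda)$ be a happy compressed temporal graph. If $\mathcal{G}$ is temporally connected and full-range (all edge labels are unique, i.e. pairwise distinct), then $\mathcal{G}$ has a pivot edge.
   Context: A happy temporal graph is a triple $\mathcal{G}=(V,E,\lambda)$ where $(V,E)$ is a finite simple undirected graph (the footprint) and $\lambda:E\to\{1,2,3,\dots\}$ assigns a single time label to each edge, such that two distinct edges sharing an endpoint have different labels. It is compressed if for every edge $e$ with $\lambda(e)>1$ there is an edge $e'$ adjacent to $e$ with $\lambda(e')=\lambda(e)-1$. A temporal walk is a walk in the footprint along which edge labels are strictly increasing (so no edge is repeated). For a vertex $v$ and an edge $e$: $v\leadsto e$ means some temporal walk starts at $v$ and traverses $e$ at some point; $e\leadsto v$ means some temporal walk traverses $e$ at some point and ends at $v$ (edges may be traversed in either direction). $\mathcal{G}$ is temporally connected if all the vertices can reach each other through temporal walks, i.e. for all distinct $u,v\in V$ there is a temporal walk from $u$ to $v$. A pivot edge is an edge $e$ such that $v\leadsto e$ and $e\leadsto v$ for all $v\in V$.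
   Formalization: The graph is additionally assumed to have at least two vertices; with at most one vertex there are no edges, so all hypotheses hold vacuously but no pivot edge exists. -}

module Defs where

open import Data.Fin using (Fin; _<_)
open import Data.List using (List; []; _∷_)
open import Data.List.Membership.Propositional using (_∈_)
open import Data.List.Relation.Unary.Linked using (Linked)
open import Data.Nat as ℕ using (ℕ; _∸_)
open import Data.Product using (Σ-syntax; ∃-syntax; _×_; _,_; proj₁; proj₂)
open import Data.Sum using (_⊎_)
open import Function.Definitions using (Injective)
open import Relation.Binary.PropositionalEquality using (_≡_; _≢_)

-- An undirected edge {u , v} is stored as the ordered pair with u < v; this
-- excludes loops and gives each two-element set exactly one representation,
-- so that injectivity of `ends` says there are no parallel edges.
record SimpleGraph : Set where
  field
    order          : ℕ
    size           : ℕ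
    ends           : Fin size → Fin order × Fin order
    ends-ordered   : ∀ e → proj₁ (ends e) < proj₂ (ends e)
    ends-injective : Injective _≡_ _≡_ ends

  Vertex : Set
  Vertex = Fin order

  Edge : Set
  Edge = Fin size

  Joins : Edge → Vertex → Vertex → Set
  Joins e u v = (ends e ≡ (u , v)) ⊎ (ends e ≡ (v , u))

  Incident : Vertex → Edge → Set
  Incident v e = (v ≡ proj₁ (ends e)) ⊎ (v ≡ proj₂ (ends e))

  Adjacent : Edge → Edge → Set
  Adjacent e e′ = e ≢ e′ × (∃[ v ] Incident v e × Incident v e′)

  data Walk : Vertex → Vertex → Set where
    nil  : ∀ {u} → Walk u u
    cons : ∀ {u v w} (e : Edge) → Joins e u v → Walk v w → Walk u w

  edges : ∀ {u v} → Walk u v → List Edge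
  edges nil          = []
  edges (cons e _ p) = e ∷ edges p

record HappyTemporalGraph : Set where
  field
    footprint : SimpleGraph

  open SimpleGraph footprint public

  field
    label          : Edge → ℕ
    label-positive : ∀ e → 1 ℕ.≤ label e
    label-proper   : ∀ e e′ → Adjacent e e′ → label e ≢ label e′

  IsTemporal : ∀ {u v} → Walk u v → Set
  IsTemporal p = Linked (λ e e′ → label e ℕ.< label e′) (edges p)

  TemporalWalk : Vertex → Vertex → Set
  TemporalWalk u v = Σ[ p ∈ Walk u v ] IsTemporal p

  Traverses : ∀ {u v} → TemporalWalk u v → Edge → Set
  Traverses (p , _) e = e ∈ edges p

  ReachesEdge : Vertex → Edge → Set
  ReachesEdge v e = ∃[ w ] Σ[ p ∈ TemporalWalk v w ] Traverses p e

  EdgeReaches : Edge → Vertex → Set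
  EdgeReaches e v = ∃[ u ] Σ[ p ∈ TemporalWalk u v ] Traverses p e

  Compressed : Set
  Compressed = ∀ e → 1 ℕ.< label e →
    ∃[ e′ ] Adjacent e′ e × label e′ ≡ label e ∸ 1

  TemporallyConnected : Set
  TemporallyConnected = ∀ u v → u ≢ v → TemporalWalk u v

  FullRange : Set
  FullRange = Injective _≡_ _≡_ label

  IsPivot : Edge → Set
  IsPivot e = ∀ v → ReachesEdge v e × EdgeReaches e v

{-# OPTIONS --safe #-}

-- Compressedness and distinct labels make the edges with consecutive labels
-- adjacent, so the set of vertices reaching an edge grows with its label and
-- the set of vertices it reaches shrinks.  Let u be a vertex whose earliest
-- incident edge e is as late as possible.  Every vertex has an incident edge no
-- later than e, hence reaches e; every temporal walk leaving u starts with an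
-- edge no earlier than e, so e reaches everything that u reaches.

module Submission where

open import Data.Fin using (Fin; zero; suc; _≟_; fromℕ<)
open import Data.List using (List; []; _∷_; [_]; _++_; allFin; filter)
open import Data.List.Extrema.Nat
  using (argmin; argmax; argmin-all; f[argmin]≤f[xs]; f[xs]≤f[argmax])
open import Data.List.Membership.Propositional using (_∈_)
open import Data.List.Membership.Propositional.Properties
  using (∈-allFin; ∈-filter⁺; ∈-++⁺ʳ)
open import Data.List.Relation.Unary.All as All using (All; []; _∷_)
open import Data.List.Relation.Unary.All.Properties using (++⁺; all-filter)
open import Data.List.Relation.Unary.AllPairs using ([]; _∷_)
import Data.List.Relation.Unary.AllPairs.Properties as AllPairs
open import Data.List.Relation.Unary.Any using (here)
open import Data.List.Relation.Unary.Linked using ([])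
open import Data.List.Relation.Unary.Linked.Properties
  using (Linked⇒AllPairs; AllPairs⇒Linked)
open import Data.Nat using (ℕ; suc; _∸_; _≤_; _<_; z≤n; s≤s; _≤′_; ≤′-refl; ≤′-step)
open import Data.Nat.Properties
  using (≤-refl; ≤-trans; <-trans; ≤⇒≤′; ≤′⇒≤)
open import Data.Product using (Σ-syntax; ∃-syntax; _×_; _,_; proj₁; proj₂)
open import Data.Sum using (_⊎_; inj₁; inj₂; swap)
open import Defs
open import Relation.Binary.PropositionalEquality
  using (_≡_; _≢_; refl; sym; trans; cong; subst)
open import Relation.Nullary using (Dec; yes; no; contradiction)
open import Relation.Nullary.Decidable using (_⊎-dec_)

other-element : ∀ {n} → 2 ≤ n → (i : Fin n) → ∃[ j ] i ≢ j
other-element (s≤s (s≤s _)) zero    = suc zero , λ ()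
other-element (s≤s (s≤s _)) (suc i) = zero , λ ()

maximiser : ∀ {n} (f : Fin n → ℕ) → Fin n → ∃[ i ] ∀ j → f j ≤ f i
maximiser {n} f i = argmax f i (allFin n) ,
  λ j → All.lookup (f[xs]≤f[argmax] {f = f} i (allFin n)) (∈-allFin j)

module _ (G : SimpleGraph) where
  open SimpleGraph G

  incident? : ∀ v e → Dec (Incident v e)
  incident? v e = (v ≟ proj₁ (ends e)) ⊎-dec (v ≟ proj₂ (ends e))

  joins-sym : ∀ {e u v} → Joins e u v → Joins e v u
  joins-sym = swap

  joins-incident : ∀ {e u v} → Joins e u v → Incident u e
  joins-incident (inj₁ eq) = inj₁ (sym (cong proj₁ eq))
  joins-incident (inj₂ eq) = inj₂ (sym (cong proj₂ eq))

  other-end : ∀ {e u} → Incident u e → ∃[ v ] Joins e u v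
  other-end (inj₁ refl) = _ , inj₁ refl
  other-end (inj₂ refl) = _ , inj₂ refl

  equal-or-joined : ∀ {e u v} → Incident u e → Incident v e → u ≡ v ⊎ Joins e u v
  equal-or-joined (inj₁ refl) (inj₁ refl) = inj₁ refl
  equal-or-joined (inj₁ refl) (inj₂ refl) = inj₂ (inj₁ refl)
  equal-or-joined (inj₂ refl) (inj₁ refl) = inj₂ (inj₂ refl)
  equal-or-joined (inj₂ refl) (inj₂ refl) = inj₁ refl

  snoc : ∀ {u v w} → Walk u v → (e : Edge) → Joins e v w → Walk u w
  snoc nil          e j = cons e j nil
  snoc (cons d i p) e j = cons d i (snoc p e j)

  edges-snoc : ∀ {u v w} (p : Walk u v) e (j : Joins e v w) →
               edges (snoc p e j) ≡ edges p ++ [ e ]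
  edges-snoc nil          e j = refl
  edges-snoc (cons d i p) e j = cong (d ∷_) (edges-snoc p e j)

module _ (G : HappyTemporalGraph) where
  open HappyTemporalGraph G

  -- The walk halts at an endpoint of `e` while `e` is still to come. Unlike in `ReachesEdge`, it
  -- can either be extended by `e` or be left as it is, which is what passing to a later edge
  -- requires.
  ArrivesBefore : Vertex → Edge → Set
  ArrivesBefore v e = ∃[ w ] Incident w e ×
    Σ[ p ∈ TemporalWalk v w ] All (λ d → label d < label e) (edges (proj₁ p))

  -- The time reversal of `ArrivesBefore`.
  DepartsAfter : Edge → Vertex → Set
  DepartsAfter e v = ∃[ w ] Incident w e ×
    Σ[ p ∈ TemporalWalk w v ] All (λ d → label e < label d) (edges (proj₁ p))

  -- `Linked` compares only neighbouring edges; transitivity of `<` turns it into `AllPairs`, where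
  -- a new last edge need only be compared with each earlier one.
  snoc-temporal : ∀ {u v w} ((p , _) : TemporalWalk u v) {e} (j : Joins e v w) →
                  All (λ d → label d < label e) (edges p) →
                  IsTemporal (snoc footprint p e j)
  snoc-temporal (p , t) {e} j before
    rewrite edges-snoc footprint p e j =
    AllPairs⇒Linked (AllPairs.++⁺ (Linked⇒AllPairs <-trans t)
      ([] ∷ []) (All.map (_∷ []) before))

  cons-temporal : ∀ {u v w e} (j : Joins e u v) ((p , _) : TemporalWalk v w) →
                  All (λ d → label e < label d) (edges p) →
                  IsTemporal (cons e j p)
  cons-temporal j (p , t) after =
    AllPairs⇒Linked (after ∷ Linked⇒AllPairs <-trans t)

  arrives⇒reaches : ∀ {v e} → ArrivesBefore v e → ReachesEdge v e
  arrives⇒reaches {e = e} (w , w∈e , (p , t) , before) with other-end footprint w∈e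
  ... | x , j = x , (snoc footprint p e j , snoc-temporal (p , t) j before) ,
    subst (e ∈_) (sym (edges-snoc footprint p e j)) (∈-++⁺ʳ (edges p) (here refl))

  departs⇒reaches : ∀ {e v} → DepartsAfter e v → EdgeReaches e v
  departs⇒reaches {e} (w , w∈e , (p , t) , after) with other-end footprint w∈e
  ... | x , j = x , (cons e (joins-sym footprint j) p ,
    cons-temporal (joins-sym footprint j) (p , t) after) , here refl

  -- The walk ends at an endpoint of `d`. If this is the vertex `x` shared with `e`, it stays there;
  -- otherwise it crosses `d` to `x`. Either way its labels are at most `label d`, hence below
  -- `label e`.
  arrives-next : ∀ {v d e} → Adjacent d e → label d < label e →
                 ArrivesBefore v d → ArrivesBefore v e
  arrives-next {d = d} {e} (_ , x , x∈d , x∈e) d<e (w , w∈d , (p , t) , before)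
    with equal-or-joined footprint w∈d x∈d
  ... | inj₁ refl = x , x∈e , (p , t) , All.map (λ l → <-trans l d<e) before
  ... | inj₂ j    = x , x∈e , (snoc footprint p d j , snoc-temporal (p , t) j before) ,
    subst (All _) (sym (edges-snoc footprint p d j))
      (++⁺ (All.map (λ l → <-trans l d<e) before) (d<e ∷ []))

  -- Reversed in time: from the shared vertex `x` the walk starts at once or crosses `e` first.
  departs-previous : ∀ {v d e} → Adjacent d e → label d < label e →
                     DepartsAfter e v → DepartsAfter d v
  departs-previous {d = d} {e} (_ , x , x∈d , x∈e) d<e (w , w∈e , (p , t) , after)
    with equal-or-joined footprint x∈e w∈e
  ... | inj₁ refl = x , x∈d , (p , t) , All.map (<-trans d<e) after
  ... | inj₂ j    = x , x∈d , (cons e j p , cons-temporal j (p , t) after) ,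
    d<e ∷ All.map (<-trans d<e) after

  module _ (compressed : Compressed) (full-range : FullRange) where

    -- Compressedness lets one descend from `e` through adjacent edges, one label at a time;
    -- distinctness of labels ensures that the edge met at `label c` is `c` itself. `R` is abstract
    -- so that one induction serves both directions of time.
    label-induction : ∀ {ℓ} (R : Edge → Edge → Set ℓ) → (∀ {e} → R e e) →
      (∀ {c d e} → Adjacent d e → label d < label e → R c d → R c e) →
      ∀ {c e} → label c ≤ label e → R c e
    label-induction R base step {c} {e} c≤e = go (≤⇒≤′ c≤e) refl
      where
      go : ∀ {n e} → label c ≤′ n → label e ≡ n → R c e
      go ≤′-refl eq = subst (R c) (full-range (sym eq)) base
      go {suc n} {e} (≤′-step c≤n) eq
        -- Here `1 ≤ label c ≤ n` and `label e ≡ suc n`, so `label e` exceeds 1.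
        with compressed e (subst (1 <_) (sym eq) (s≤s (≤-trans (label-positive c) (≤′⇒≤ c≤n))))
      ... | d , adj , d≡ = step adj d<e (go c≤n d≡n)
        where
        d≡n : label d ≡ n
        d≡n = trans d≡ (cong (_∸ 1) eq)

        d<e : label d < label e
        d<e = subst (label d <_) (sym eq) (subst (_< suc n) (sym d≡n) ≤-refl)

    arrives-mono : ∀ {v c e} → label c ≤ label e →
                   ArrivesBefore v c → ArrivesBefore v e
    arrives-mono {v} = label-induction (λ c e → ArrivesBefore v c → ArrivesBefore v e)
      (λ a → a) (λ adj d<e ih a → arrives-next adj d<e (ih a))

    departs-anti : ∀ {v c e} → label c ≤ label e →
                   DepartsAfter e v → DepartsAfter c v
    departs-anti {v} = label-induction (λ c e → DepartsAfter e v → DepartsAfter c v)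
      (λ a → a) (λ adj d<e ih a → ih (departs-previous adj d<e a))

  -- Distinct ends rule out the empty walk, so there is a first edge, and it precedes all the
  -- others. This also shows that `u` has an incident edge at all.
  first-step : ∀ {u v} → u ≢ v → TemporalWalk u v →
               ∃[ e ] Incident u e × DepartsAfter e v
  first-step u≢v (nil , _) = contradiction refl u≢v
  first-step u≢v (cons e j p , t) with Linked⇒AllPairs <-trans t
  ... | after ∷ rest =
    e , joins-incident footprint j ,
    _ , joins-incident footprint (joins-sym footprint j) , (p , AllPairs⇒Linked rest) , after

  Earliest : Vertex → Edge → Set
  Earliest v e = Incident v e × (∀ {d} → Incident v d → label e ≤ label d)

  earliest-incident : ∀ {v e} → Incident v e → ∃[ d ] Earliest v d
  earliest-incident {v} {e} v∈e =
    -- The default `e` is itself incident to `v`, so the minimiser is incident whether it is the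
    -- default or comes from `es`.
    argmin label e es ,
    argmin-all label v∈e (all-filter (incident? footprint v) (allFin size)) ,
    λ {c} v∈c → All.lookup (f[argmin]≤f[xs] e es)
                  (∈-filter⁺ (incident? footprint v) (∈-allFin c) v∈c)
    where
    es : List Edge
    es = filter (incident? footprint v) (allFin size)

  latest-earliest-isPivot : Compressed → TemporallyConnected → FullRange →
    (first : Vertex → Edge) → (∀ v → Earliest v (first v)) →
    ∀ u → (∀ v → label (first v) ≤ label (first u)) → IsPivot (first u)
  latest-earliest-isPivot compressed connected full-range first earliest u latest v =
    -- The empty walk at `v` arrives before `first v`, an edge at `v`; monotonicity carries this on
    -- to `first u`.
    arrives⇒reaches (arrives-mono compressed full-range (latest v)
      (v , proj₁ (earliest v) , (nil , []) , [])) ,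
    departs⇒reaches departs
    where
    departs : DepartsAfter (first u) v
    departs with u ≟ v
    ... | yes refl = u , proj₁ (earliest u) , (nil , []) , []
    ... | no u≢v with first-step u≢v (connected u v u≢v)
    ...   | d , u∈d , after =
      departs-anti compressed full-range (proj₂ (earliest u) u∈d) after

lemma3p30 : (G : HappyTemporalGraph) →
    let open HappyTemporalGraph G in
    2 ≤ order →
    Compressed →
    TemporallyConnected →
    FullRange →
    ∃[ e ] IsPivot e
lemma3p30 G 2≤n compressed connected full-range =
  first u ,
  latest-earliest-isPivot G compressed connected full-range
    first (λ v → proj₂ (earliest v)) u (proj₂ latest)
  where
  open HappyTemporalGraph G

  earliest : ∀ v → ∃[ e ] Earliest G v e
  -- A second vertex `w` exists as the order is at least 2, and a walk from `v` to `w` must leave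
  -- `v` along some edge.
  earliest v with other-element 2≤n v
  ... | w , v≢w = earliest-incident G (proj₁ (proj₂ (first-step G v≢w (connected v w v≢w))))

  first : Vertex → Edge
  first v = proj₁ (earliest v)

  latest : ∃[ u ] ∀ v → label (first v) ≤ label (first u)
  -- Vertex 0 is the default value for the maximum.
  latest = maximiser (λ v → label (first v)) (fromℕ< (≤-trans (s≤s z≤n) 2≤n))

  u : Vertex
  u = proj₁ latest
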